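{- For any $\delta > 0$, there exists a token swapping instance $K = (G, T, f_1, f_2)$ such that $OPT(K) \geq (2-\delta) \cdot total(K)$, where $$total(K) := \sum_{t \in T} \mathrm{dist}(f_1(t), f_2(t)).$$
   Context: A Token Swapping instance $K = (G, T, f_1, f_2)$ consists of an undirected graph $G = (V,E)$, a set of (distinct) tokens $T$ with $|T| = |V|$, and two one-to-one assignments $f_1, f_2 : T \to V$, called the starting and target configurations respectively. A swap along an edge $(u,v) \in E$ switches the locations of the tokens currently on $u$ and $v$. $OPT(K)$ denotes the length (number of swaps) of the shortest swap sequence that transforms the starting configuration into the target configuration. $\mathrm{dist}$ denotes graph distance in $G$. -}

module Defs where

open import Data.Fin using (Fin)
open import Data.Fin.Permutation.Components using (transpose)
open import Data.List using (List; foldl; length)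
open import Data.Nat using (ℕ; zero; suc; _≤_)
open import Data.Nat.Properties using (+-0-monoid)
open import Data.Product using (Σ-syntax; _×_; _,_)
open import Function using (_∘_; _↣_; Injection)
open import Level using (0ℓ)
open import Relation.Binary using (Rel; Symmetric; Irreflexive; Decidable)
open import Relation.Binary.PropositionalEquality using (_≡_; _≗_)

open import Algebra.Properties.Monoid.Sum +-0-monoid using (sum)

record Graph (n : ℕ) : Set₁ where
  field
    _∼_      : Rel (Fin n) 0ℓ
    ∼-sym    : Symmetric _∼_
    ∼-irrefl : Irreflexive _≡_ _∼_
    _∼?_     : Decidable _∼_

IsMinimum : (ℕ → Set) → ℕ → Set
IsMinimum P m = P m × (∀ k → P k → m ≤ k)

module _ {n : ℕ} (G : Graph n) where
  open Graph G

  data Walk : Fin n → Fin n → ℕ → Set where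
    here : ∀ {u} → Walk u u zero
    step : ∀ {u v w k} → u ∼ v → Walk v w k → Walk u w (suc k)

  -- No d satisfies this when u and v lie in different components.
  IsDist : Fin n → Fin n → ℕ → Set
  IsDist u v = IsMinimum (Walk u v)

  Edge : Set
  Edge = Σ[ u ∈ Fin n ] Σ[ v ∈ Fin n ] u ∼ v

-- Vertices and tokens are both numbered by Fin n, so |T| = |V| holds by
-- construction and the injections below are bijections.
record Instance : Set₁ where
  field
    n      : ℕ
    graph  : Graph n
    start  : Fin n ↣ Fin n
    target : Fin n ↣ Fin n

  Token Vertex : Set
  Token  = Fin n
  Vertex = Fin n

  f₁ f₂ : Token → Vertex
  f₁ = Injection.to start
  f₂ = Injection.to target

-- A placement sends each token to its location. After a swap along (u , v),
-- the token that was on u is on v and vice versa.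
swap : ∀ {n} {G : Graph n} → (Fin n → Fin n) → Edge G → (Fin n → Fin n)
swap f (u , v , _) = transpose u v ∘ f

module _ (K : Instance) where
  open Instance K

  Transforms : List (Edge graph) → Set
  Transforms es = foldl (swap {G = graph}) f₁ es ≗ f₂

  -- "OPT(K) = m". The relation is functional, and no m satisfies it when the
  -- target configuration cannot be reached.
  IsOPT : ℕ → Set
  IsOPT = IsMinimum (λ k → Σ[ es ∈ List (Edge graph) ] length es ≡ k × Transforms es)

  -- "total(K) = s", where all the distances occurring in the sum are finite.
  IsTotal : ℕ → Set
  IsTotal s = Σ[ d ∈ (Token → ℕ) ] (∀ t → IsDist graph (f₁ t) (f₂ t) (d t)) × s ≡ sum d

-- Cut a cycle of length m L into m blocks of L vertices. The first token of
-- each block moves to the start of the next block and all others stay, so the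
-- distances add up to at most m L. The winding numbers of the tokens under any
-- swap sequence sum to zero, whereas sending all movers forward would give
-- total winding one; so, measured against that rotation, two tokens t₀ and t₁
-- in different blocks differ in winding. Then each block not containing t₀ or
-- t₁ forces 2 L - 1 crossings of its own: L because each of its tokens differs
-- in winding from t₀ or from t₁ and hence crosses it, and L - 1 because its
-- mover i either overtakes a stationary token j of the block or differs in
-- winding from it, in which case a third token crosses i or j. Hence OPT is at
-- least (m - 2) (2 L - 1).

module Submission where

open import Defs

-- Decidability of bounded search, and minima.

module Search where
  open import Data.Fin using (Fin)
  open import Data.Fin.Permutation.Components using (transpose)
  open import Data.Fin.Properties using (_≟_; any?; all?)
  open import Data.List using (List; []; _∷_; foldl; length)
  open import Data.Nat using (ℕ; zero; suc; _≤_; z≤n; s≤s)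
  open import Data.Nat.Properties using (suc-injective)
  open import Data.Product using (Σ-syntax; ∃-syntax; _×_; _,_)
  open import Function using (_∘_)
  open import Relation.Binary.PropositionalEquality using (_≡_; refl; cong; _≗_)
  open import Relation.Nullary using (Dec; yes; no; contradiction)
  open import Relation.Nullary.Decidable using (map′; _×-dec_)

  -- Distances and OPT enter the theorem as exact minima; this produces them from a decidable
  -- predicate and any witness. The bound `m ≤ k` turns an explicit walk into an upper bound on the
  -- distance.
  least : {P : ℕ → Set} → (∀ k → Dec (P k)) → ∀ {k} → P k →
          ∃[ m ] IsMinimum P m × m ≤ k
  least P? {zero}  p = 0 , (p , λ _ _ → z≤n) , z≤n
  least P? {suc k} p with P? 0
  ... | yes p₀ = 0 , (p₀ , λ _ _ → z≤n) , z≤n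
  ... | no ¬p₀ =
    let m , (pₘ , minimal) , m≤k = least (P? ∘ suc) p
    in suc m
     , (pₘ , λ { zero    p₀ → contradiction p₀ ¬p₀
               ; (suc j) pⱼ → s≤s (minimal j pⱼ) })
     , s≤s m≤k

  module _ {n} (G : Graph n) where
    open Graph G

    walk? : ∀ u w k → Dec (Walk G u w k)
    walk? u w zero    = map′ (λ { refl → here }) (λ { here → refl }) (u ≟ w)
    walk? u w (suc k) =
      map′ (λ { (_ , e , p) → step e p }) (λ { (step e p) → _ , e , p })
           (any? λ v → (u ∼? v) ×-dec walk? v w k)

    -- The recursion is on the first swap, which `foldl` absorbs into the initial placement; hence
    -- `f` must vary.
    swaps? : ∀ (f g : Fin n → Fin n) k →
             Dec (Σ[ es ∈ List (Edge G) ] length es ≡ k × foldl (swap {G = G}) f es ≗ g)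
    swaps? f g zero =
      map′ (λ f≗g → [] , refl , f≗g) (λ { ([] , _ , f≗g) → f≗g })
           (all? λ t → f t ≟ g t)
    swaps? f g (suc k) =
      map′ (λ { (u , v , e , es , len , eq) → (u , v , e) ∷ es , cong suc len , eq })
           (λ { ((u , v , e) ∷ es , len , eq) → u , v , e , es , suc-injective len , eq })
           (any? λ u → any? λ v → (u ∼? v) ×-dec swaps? (transpose u v ∘ f) g k)

-- Transpositions of vertices.

module Transposition where
  open import Data.Fin using (Fin)
  open import Data.Fin.Permutation.Components using (transpose; transpose-inverse)
  open import Data.Fin.Properties using (_≟_)
  open import Relation.Binary.PropositionalEquality using (_≡_; _≢_; refl; sym; trans; cong)
  open import Relation.Nullary using (yes; no)
  open import Relation.Nullary.Decidable using (dec-true; dec-false)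

  module _ {n} (u v : Fin n) where

    transpose-u : transpose u v u ≡ v
    transpose-u rewrite dec-true (u ≟ u) refl = refl

    transpose-v : transpose u v v ≡ u
    transpose-v with v ≟ u
    ... | yes v≡u = v≡u
    ... | no  _ rewrite dec-true (v ≟ v) refl = refl

    transpose-off : ∀ {x} → x ≢ u → x ≢ v → transpose u v x ≡ x
    transpose-off {x} x≢u x≢v
      rewrite dec-false (x ≟ u) x≢u | dec-false (x ≟ v) x≢v = refl

    transpose-injective : ∀ {x y} → transpose u v x ≡ transpose u v y → x ≡ y
    transpose-injective eq =
      trans (sym (transpose-inverse v u))
            (trans (cong (transpose v u) eq) (transpose-inverse v u))

    data Spot : Fin n → Set where
      at-u : Spot u
      at-v : Spot v
      off  : ∀ {x} → x ≢ u → x ≢ v → Spot x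

    spot : ∀ x → Spot x
    spot x with x ≟ u | x ≟ v
    ... | yes refl | _        = at-u
    ... | no _     | yes refl = at-v
    ... | no x≢u   | no x≢v   = off x≢u x≢v

-- On a connected graph every injective target is reachable by swaps.

module Routing where
  open import Data.Fin using (Fin; toℕ; fromℕ<)
  open import Data.Fin.Permutation.Components using (transpose)
  open import Data.Fin.Properties using (_≟_; toℕ-fromℕ<; toℕ-injective; toℕ<n)
  open import Data.List using (List; []; _∷_; _++_; foldl)
  open import Data.List.Properties using (foldl-++)
  open import Data.Nat using (zero; suc; _+_; _≤_; _<_)
  open import Data.Nat.Properties using (≤-refl; <⇒≤; <⇒≢; m<1+n⇒m<n∨m≡n)
  open import Data.Product using (∃-syntax; _×_; _,_; proj₂)
  open import Data.Sum using (inj₁; inj₂)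
  open import Function using (_∘_; id; Injective)
  open import Relation.Binary.PropositionalEquality
    using (_≡_; _≢_; refl; sym; trans; cong; _≗_)
  open import Relation.Nullary using (yes; no)
  open Transposition

  module _ {n} (G : Graph n) where
    open Graph G

    _++ʷ_ : ∀ {u v w j k} → Walk G u v j → Walk G v w k → Walk G u w (j + k)
    here     ++ʷ q = q
    step e p ++ʷ q = step e (p ++ʷ q)

    -- Swaps act on locations, so a swap sequence acts by composition on the left, uniformly in the
    -- placement `f`. This uniformity makes realisable maps closed under composition.
    record Realisable (τ : Fin n → Fin n) : Set where
      constructor realised
      field
        swaps    : List (Edge G)
        realises : ∀ f → foldl (swap {G = G}) f swaps ≗ τ ∘ f

    realise-cong : ∀ {σ τ} → Realisable σ → σ ≗ τ → Realisable τ
    realise-cong (realised es p) σ≗τ = realised es λ f t → trans (p f t) (σ≗τ (f t))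

    realise-id : Realisable id
    realise-id = realised [] λ _ _ → refl

    realise-∘ : ∀ {σ} τ → Realisable σ → Realisable τ → Realisable (τ ∘ σ)
    realise-∘ τ (realised es p) (realised es′ q) = realised (es ++ es′) λ f t →
      trans (cong (λ h → h t) (foldl-++ (swap {G = G}) f es es′))
            (trans (q (foldl (swap {G = G}) f es) t) (cong τ (p f t)))

    realise-edge : ∀ {u v} → u ∼ v → Realisable (transpose u v)
    realise-edge {u} {v} e = realised ((u , v , e) ∷ []) λ _ _ → refl

    -- Induction along the walk by conjugation: (u w) = (u v)(v w)(u v). The identity needs `u`,
    -- `v`, `w` pairwise distinct, so walks with `u ≡ w` or `v ≡ w` are treated first.
    realise-transpose : ∀ {u w k} → Walk G u w k → Realisable (transpose u w)
    realise-transpose {u} here = realise-cong realise-id (sym ∘ fixed) where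
      fixed : ∀ x → transpose u u x ≡ x
      fixed x with spot u u x
      ... | at-u    = transpose-u u u
      ... | at-v    = transpose-u u u
      ... | off p q = transpose-off u u p q
    realise-transpose {u} {w} (step {v = v} e p) with u ≟ w
    ... | yes refl = realise-transpose {u} here
    ... | no u≢w with v ≟ w
    ...   | yes refl = realise-edge e
    ...   | no v≢w   =
      realise-cong
        (realise-∘ (transpose u v)
          (realise-∘ (transpose v w) (realise-edge e) (realise-transpose p))
          (realise-edge e))
        conjugate
      where
      u≢v : u ≢ v
      u≢v u≡v = ∼-irrefl u≡v e
      conjugate : ∀ x → transpose u v (transpose v w (transpose u v x)) ≡ transpose u w x
      conjugate x with spot u w x
      ... | at-u rewrite transpose-u u v | transpose-u v w | transpose-u u w
        = transpose-off u v (u≢w ∘ sym) (v≢w ∘ sym)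
      ... | at-v rewrite transpose-off u v (u≢w ∘ sym) (v≢w ∘ sym)
                       | transpose-v v w | transpose-v u w
        = transpose-v u v
      ... | off x≢u x≢w with x ≟ v
      ...   | yes refl rewrite transpose-v u v | transpose-off v w u≢v u≢w
                             | transpose-off u w x≢u x≢w
        = transpose-u u v
      ...   | no x≢v rewrite transpose-off u v x≢u x≢v | transpose-off v w x≢v x≢w
                           | transpose-off u w x≢u x≢w
        = transpose-off u v x≢u x≢v

    module _ (walk : ∀ u w → ∃[ k ] Walk G u w k)
             (g : Fin n → Fin n) (g-injective : Injective _≡_ _≡_ g) where

      -- Tokens are settled one at a time in the order of their numbers: token `s`, with number `k`,
      -- trades places with whatever occupies its target.
      place : ∀ k → k ≤ n →
              ∃[ τ ] Realisable τ × Injective _≡_ _≡_ τ × (∀ t → toℕ t < k → τ t ≡ g t)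
      place zero    _   = id , realise-id , id , λ _ ()
      place (suc k) k<n with τ , r , τ-injective , placed ← place k (<⇒≤ k<n) =
        ρ ∘ τ
        , realise-∘ ρ r (realise-transpose (proj₂ (walk (τ s) (g s))))
        , τ-injective ∘ transpose-injective (τ s) (g s)
        , placed′
        where
        s = fromℕ< k<n
        ρ = transpose (τ s) (g s)
        placed′ : ∀ t → toℕ t < suc k → ρ (τ t) ≡ g t
        placed′ t t<1+k with m<1+n⇒m<n∨m≡n t<1+k
        -- A settled token is not disturbed: it is not at `τ s` because `τ` is injective, nor at
        -- `g s` because `g` is.
        ... | inj₁ t<k = trans
          (transpose-off (τ s) (g s) (t≢s ∘ τ-injective)
            (λ eq → t≢s (g-injective (trans (sym (placed t t<k)) eq))))
          (placed t t<k)
          where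
          t≢s : t ≢ s
          t≢s t≡s = <⇒≢ t<k (trans (cong toℕ t≡s) (toℕ-fromℕ< k<n))
        ... | inj₂ t≡k with refl ← toℕ-injective {i = t} {j = s} (trans t≡k (sym (toℕ-fromℕ< k<n)))
          = transpose-u (τ s) (g s)

      realise-injective : Realisable g
      realise-injective with τ , r , _ , placed ← place n ≤-refl
        = realise-cong r λ t → placed t (toℕ<n t)

-- The cycle graph and walks on it.

module Cycle where
  open import Data.Empty using (⊥)
  open import Relation.Nullary using (Dec)
  open import Data.Fin using (Fin; zero; suc; toℕ; fromℕ)
  open import Data.Fin.Properties using (_≟_; toℕ-fromℕ; toℕ-fromℕ<; toℕ-injective; toℕ<n; toℕ≤pred[n])
  open import Data.Nat using (ℕ; zero; suc; _+_; _∸_; _<_)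
  open import Data.Nat.Properties as ℕ using (1+n≢n; +-suc; +-identityʳ; m≤m+n; m+[n∸m]≡n)
  open import Data.Product using (∃-syntax; _×_; _,_)
  open import Data.Sum using (_⊎_; inj₁; inj₂) renaming (swap to ⊎-swap)
  open import Relation.Binary.PropositionalEquality using (_≡_; refl; sym; trans; cong; subst)
  open import Relation.Nullary.Decidable using (_⊎-dec_; _×-dec_)
  open Routing

  -- An edge taken in the positive direction. The orientation is kept because winding numbers are
  -- signed; the second alternative closes the cycle.
  Arc : ∀ {n} → Fin (suc n) → Fin (suc n) → Set
  Arc {n} u v = suc (toℕ u) ≡ toℕ v ⊎ (u ≡ fromℕ n × v ≡ zero)

  cycle : ∀ n → Graph (2 + n)
  cycle n = record
    { _∼_      = λ u v → Arc u v ⊎ Arc v u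
    ; ∼-sym    = ⊎-swap
    ; ∼-irrefl = λ { refl (inj₁ a) → loopless a ; refl (inj₂ a) → loopless a }
    ; _∼?_     = λ u v → arc? u v ⊎-dec arc? v u
    }
    where
    loopless : ∀ {u : Fin (2 + n)} → Arc u u → ⊥
    loopless (inj₁ 1+u≡u)        = 1+n≢n 1+u≡u
    loopless (inj₂ (refl , ()))
    arc? : ∀ (u v : Fin (2 + n)) → Dec (Arc u v)
    arc? u v = (suc (toℕ u) ℕ.≟ toℕ v) ⊎-dec ((u ≟ fromℕ (suc n)) ×-dec (v ≟ zero))

  module _ {n : ℕ} where

    climb : ∀ k {u v : Fin (2 + n)} → toℕ u + k ≡ toℕ v → Walk (cycle n) u v k
    climb zero    {u} u+0≡v
      with refl ← toℕ-injective (trans (sym (+-identityʳ (toℕ u))) u+0≡v) = here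
    climb (suc k) {u} {v} u+1+k≡v =
      step (inj₁ (inj₁ (sym (toℕ-fromℕ< 1+u<n))))
           (climb k (trans (cong (_+ k) (toℕ-fromℕ< 1+u<n)) 1+u+k≡v))
      where
      1+u+k≡v : suc (toℕ u) + k ≡ toℕ v
      1+u+k≡v = trans (sym (+-suc (toℕ u) k)) u+1+k≡v
      1+u<n : suc (toℕ u) < 2 + n
      1+u<n = ℕ.≤-<-trans (m≤m+n (suc (toℕ u)) k) (subst (_< 2 + n) (sym 1+u+k≡v) (toℕ<n v))

    -- Climb to the last vertex, cross the closing edge to vertex 0, climb again to `w`. This gives
    -- connectedness and also the route of the mover of the last block.
    climb-over : ∀ k {u : Fin (2 + n)} w → toℕ u + k ≡ suc n →
                 Walk (cycle n) u w (k + suc (toℕ w))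
    climb-over k w u+k≡1+n =
      _++ʷ_ (cycle n) (climb k (trans u+k≡1+n (sym (toℕ-fromℕ (suc n)))))
                      (step (inj₁ (inj₂ (refl , refl))) (climb (toℕ w) refl))

    connected : ∀ u w → ∃[ k ] Walk (cycle n) u w k
    connected u w = _ , climb-over (suc n ∸ toℕ u) w (m+[n∸m]≡n (toℕ≤pred[n] u))

-- Indicator functions and Kronecker deltas.

module Indicator where
  open import Data.Bool using (if_then_else_)
  open import Data.Integer using (ℤ; 0ℤ; 1ℤ)
  open import Data.Fin using (Fin; zero; suc)
  open import Data.Fin.Properties using (_≟_)
  open import Data.Nat using (ℕ; suc)
  import Data.Integer.Properties as ℤ
  import Data.Nat.Properties as ℕ
  open import Relation.Binary.PropositionalEquality using (_≡_; refl; sym; trans)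
  open import Relation.Nullary using (Dec; does; yes; no; ¬_)
  open import Relation.Nullary.Decidable using (dec-true; dec-false)
  open import Function using (_∘_)
  open import Algebra using (Semiring)
  open import Level using (0ℓ)

  𝟙 : ∀ {P : Set} → Dec P → ℤ
  𝟙 d = if does d then 1ℤ else 0ℤ

  𝟙-yes : ∀ {P : Set} (d : Dec P) → P → 𝟙 d ≡ 1ℤ
  𝟙-yes d p rewrite dec-true d p = refl

  𝟙-no : ∀ {P : Set} (d : Dec P) → ¬ P → 𝟙 d ≡ 0ℤ
  𝟙-no d ¬p rewrite dec-false d ¬p = refl

  𝟙-⇔ : ∀ {P Q : Set} (d : Dec P) (e : Dec Q) → (P → Q) → (Q → P) → 𝟙 d ≡ 𝟙 e
  𝟙-⇔ (yes p) e p⇒q _ = sym (𝟙-yes e (p⇒q p))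
  𝟙-⇔ (no ¬p) e _ q⇒p = sym (𝟙-no e (¬p ∘ q⇒p))

  -- Instantiated over ℕ to count crossings and over ℤ for winding numbers.
  module Kronecker (R : Semiring 0ℓ 0ℓ) where
    open Semiring R using (Carrier; 0#; 1#; _≈_; +-identityˡ; +-identityʳ; +-cong; +-congˡ)
      renaming (refl to ≈-refl; trans to ≈-trans; sym to ≈-sym; reflexive to ≈-reflexive)
    open import Algebra.Properties.Semiring.Sum R

    δ : ∀ {n} → Fin n → Fin n → Carrier
    δ u x = if does (x ≟ u) then 1# else 0#

    δ-≡ : ∀ {n} (u : Fin n) → δ u u ≡ 1#
    δ-≡ u rewrite dec-true (u ≟ u) refl = refl

    δ-≢ : ∀ {n} {u x : Fin n} → ¬ x ≡ u → δ u x ≡ 0#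
    δ-≢ {u = u} {x} x≢u rewrite dec-false (x ≟ u) x≢u = refl

    δ-suc : ∀ {n} (u x : Fin n) → δ (suc u) (suc x) ≡ δ u x
    δ-suc u x with x ≟ u
    ... | yes _ = refl
    ... | no  _ = refl

    sum-δ : ∀ {n} (u : Fin n) → sum (δ u) ≈ 1#
    sum-δ {suc n} zero    = ≈-trans (+-congˡ (sum-replicate-zero n)) (+-identityʳ 1#)
    sum-δ {suc n} (suc u) =
      ≈-trans (+-identityˡ _) (≈-trans (≈-reflexive (sum-cong-≗ (δ-suc u))) (sum-δ u))

-- Winding numbers and crossings of tokens on a cycle.

module Crossing where
  open import Data.Fin using (Fin; zero; suc; toℕ; _<_)
  open import Data.Fin.Permutation using (Permutation′; _⟨$⟩ʳ_; _∘ₚ_)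
  import Data.Fin.Permutation as Perm
  open import Data.Fin.Permutation.Components using (transpose)
  open import Data.Fin.Properties using (_<?_; toℕ-injective; toℕ-fromℕ; toℕ≤pred[n])
  open import Data.Integer using (ℤ; -_; _+_; _-_; _*_; ∣_∣; 0ℤ; 1ℤ)
  open import Data.Integer.Properties as ℤ using (+-inverseʳ; ∣-i∣≡∣i∣; ∣i+j∣≤∣i∣+∣j∣)
  open import Data.Integer.Tactic.RingSolver using (solve-∀)
  open import Data.List using (List; []; _∷_; foldl; length)
  open import Data.Nat as ℕ using (ℕ; suc; _≤_; z≤n; s≤s)
  import Data.Nat.Properties as ℕ
  open import Data.Nat.Tactic.RingSolver renaming (solve-∀ to ℕ-solve-∀)
  open import Data.Product using (_,_)
  open import Data.Sum using (inj₁; inj₂)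
  open import Function using (_∘_)
  open import Relation.Binary.PropositionalEquality
    using (_≡_; _≢_; refl; sym; trans; cong; cong₂; subst; module ≡-Reasoning)
  open Cycle
  open Indicator
  open Transposition
  open Kronecker ℕ.+-*-semiring
  open Kronecker ℤ.+-*-semiring renaming (δ to δℤ; δ-≡ to δℤ-≡; δ-≢ to δℤ-≢; sum-δ to sum-δℤ)
  open import Algebra.Properties.Semiring.Sum ℕ.+-*-semiring using (sum; sum-cong-≗; *-distribˡ-sum; sum-replicate-zero)
  open import Algebra.Properties.CommutativeMonoid.Sum ℕ.+-0-commutativeMonoid using (∑-distrib-+; sum-permute)
  open import Algebra.Properties.Semiring.Sum ℤ.+-*-semiring
    renaming (sum to sumℤ; sum-replicate-zero to sumℤ-zero; *-distribˡ-sum to *-distribˡ-sumℤ) using ()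
  open import Algebra.Properties.CommutativeMonoid.Sum ℤ.+-0-commutativeMonoid
    renaming (∑-distrib-+ to ∑ℤ-distrib-+; sum-permute to sumℤ-permute) using ()

  lt : ∀ {n} → Fin n → Fin n → ℤ
  lt x y = 𝟙 (x <? y)

  -- Crossing the edge changes the winding number of the token on u by turn
  -- and that of the token on v by - turn. As seen from a third vertex this
  -- compensates exactly the change in the linear order of the positions.
  record Turn {n} (u v : Fin n) : Set where
    field
      turn    : ℤ
      above   : ∀ {y} → y ≢ u → y ≢ v → lt v y - lt u y ≡ turn
      below   : ∀ {y} → y ≢ u → y ≢ v → lt y u - lt y v ≡ turn
      between : ∣ (- turn - turn) + (lt v u - lt u v) ∣ ≤ 1

  opposite : ∀ {n} {u v : Fin n} → Turn u v → Turn v u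
  opposite {u = u} {v} T = record
    { turn    = - turn
    ; above   = λ {y} p q → trans (negate (lt u y) (lt v y)) (cong -_ (above q p))
    ; below   = λ {y} p q → trans (negate (lt y v) (lt y u)) (cong -_ (below q p))
    ; between = subst (_≤ 1) (trans (sym (∣-i∣≡∣i∣ ((- turn - turn) + (lt v u - lt u v)))) (cong ∣_∣ (flip turn (lt v u) (lt u v)))) between
    }
    where
    open Turn T
    negate : ∀ a b → a - b ≡ - (b - a)
    negate = solve-∀
    flip : ∀ t a b → - ((- t - t) + (a - b)) ≡ (- - t - - t) + (b - a)
    flip = solve-∀

  -- Along an inner arc nothing winds, and no third vertex lies between the two neighbours, so it
  -- sees no change of order. Along the closing arc the winding is 1: `u` is the largest and `v` the
  -- smallest vertex, so the order with respect to every third vertex is reversed.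
  arc-turn : ∀ {n} {u v : Fin (2 ℕ.+ n)} → Arc u v → Turn u v
  arc-turn {n} {u} {v} (inj₁ 1+u≡v) = record
    { turn    = 0ℤ
    ; above   = λ {y} _ y≢v → cancel (𝟙-⇔ (v <? y) (u <? y) (ℕ.<-trans u<v) (up y≢v))
    ; below   = λ {y} y≢u _ → cancel (𝟙-⇔ (y <? u) (y <? v) (λ y<u → ℕ.<-trans y<u u<v) (down y≢u))
    ; between = inside
    }
    where
    cancel : ∀ {a b} → a ≡ b → a - b ≡ 0ℤ
    cancel {a} refl = +-inverseʳ a
    u<v : u < v
    u<v = ℕ.≤-reflexive 1+u≡v
    up : ∀ {y} → y ≢ v → u < y → v < y
    up y≢v u<y = ℕ.≤∧≢⇒< (subst (_≤ _) 1+u≡v u<y) (λ eq → y≢v (sym (toℕ-injective eq)))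
    down : ∀ {y} → y ≢ u → y < v → y < u
    down y≢u y<v = ℕ.≤∧≢⇒< (ℕ.s≤s⁻¹ (subst (suc _ ≤_) (sym 1+u≡v) y<v)) (y≢u ∘ toℕ-injective)
    inside : ∣ 0ℤ + (lt v u - lt u v) ∣ ≤ 1
    inside rewrite 𝟙-no (v <? u) (ℕ.<-asym u<v) | 𝟙-yes (u <? v) u<v = ℕ.≤-refl
  arc-turn {n} {u} {v} (inj₂ (refl , refl)) = record
    { turn    = 1ℤ
    ; above   = λ {y} _ y≢0 → cong₂ _-_ (𝟙-yes (v <? y) (0<y y≢0)) (𝟙-no (u <? y) (ℕ.≤⇒≯ (y≤u y)))
    ; below   = λ {y} y≢u _ → cong₂ _-_ (𝟙-yes (y <? u) (y<u y≢u)) (𝟙-no (y <? v) λ ())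
    ; between = inside
    }
    where
    0<y : ∀ {y : Fin (2 ℕ.+ n)} → y ≢ zero → v < y
    0<y {zero}  y≢0 with () ← y≢0 refl
    0<y {suc _} _   = s≤s z≤n
    y≤u : ∀ y → toℕ y ≤ toℕ u
    y≤u y = subst (toℕ y ≤_) (sym (toℕ-fromℕ (suc n))) (toℕ≤pred[n] y)
    y<u : ∀ {y} → y ≢ u → y < u
    y<u {y} y≢u = ℕ.≤∧≢⇒< (y≤u y) (y≢u ∘ toℕ-injective)
    inside : ∣ (- 1ℤ - 1ℤ) + (lt v u - lt u v) ∣ ≤ 1
    inside rewrite 𝟙-yes (v <? u) (s≤s z≤n) | 𝟙-no (u <? v) (λ ()) = ℕ.≤-refl

  edge-turn : ∀ {n} {u v} → Graph._∼_ (cycle n) u v → Turn u v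
  edge-turn (inj₁ a) = arc-turn a
  edge-turn (inj₂ a) = opposite (arc-turn a)

  module Swap {n} {u v : Fin n} (u≢v : u ≢ v) (T : Turn u v) where
    open Turn T

    -- The winding gained in this swap by the token standing on a given vertex.
    ω : Fin n → ℤ
    ω x = turn * δℤ u x + - turn * δℤ v x

    -- Counts ordered pairs, so that each swap contributes exactly one to the double sum.
    hit : Fin n → Fin n → ℕ
    hit x y = δ u x ℕ.* δ v y

    ω-u : ω u ≡ turn
    ω-u rewrite δℤ-≡ u | δℤ-≢ u≢v = eq turn
      where eq : ∀ t → t * 1ℤ + - t * 0ℤ ≡ t
            eq = solve-∀

    ω-v : ω v ≡ - turn
    ω-v rewrite δℤ-≡ v | δℤ-≢ (u≢v ∘ sym) = eq turn
      where eq : ∀ t → t * 0ℤ + - t * 1ℤ ≡ - t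
            eq = solve-∀

    ω-off : ∀ {x} → x ≢ u → x ≢ v → ω x ≡ 0ℤ
    ω-off x≢u x≢v rewrite δℤ-≢ x≢u | δℤ-≢ x≢v = eq turn
      where eq : ∀ t → t * 0ℤ + - t * 0ℤ ≡ 0ℤ
            eq = solve-∀

    sum-ω : sumℤ ω ≡ 0ℤ
    sum-ω = begin
      sumℤ ω
        ≡⟨ ∑ℤ-distrib-+ (λ x → turn * δℤ u x) (λ x → - turn * δℤ v x) ⟩
      sumℤ (λ x → turn * δℤ u x) + sumℤ (λ x → - turn * δℤ v x)
        ≡⟨ cong₂ _+_ (*-distribˡ-sumℤ turn (δℤ u)) (*-distribˡ-sumℤ (- turn) (δℤ v)) ⟨
      turn * sumℤ (δℤ u) + - turn * sumℤ (δℤ v)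
        ≡⟨ cong₂ (λ a b → turn * a + - turn * b) (sum-δℤ u) (sum-δℤ v) ⟩
      turn * 1ℤ + - turn * 1ℤ
        ≡⟨ eq turn ⟩
      0ℤ ∎
      where
      open ≡-Reasoning
      eq : ∀ t → t * 1ℤ + - t * 1ℤ ≡ 0ℤ
      eq = solve-∀

    sum-hit : sum (λ x → sum (hit x)) ≡ 1
    sum-hit = begin
      sum (λ x → sum (hit x))      ≡⟨ sum-cong-≗ (λ x → *-distribˡ-sum (δ u x) (δ v)) ⟨
      sum (λ x → δ u x ℕ.* sum (δ v)) ≡⟨ sum-cong-≗ (λ x → trans (cong (δ u x ℕ.*_) (sum-δ v)) (ℕ.*-identityʳ _)) ⟩
      sum (δ u)                    ≡⟨ sum-δ u ⟩
      1 ∎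
      where open ≡-Reasoning

    τ : Fin n → Fin n
    τ = transpose u v

    private
      vanish : ∀ {i j} → i ≡ 0ℤ → ∣ i ∣ ≤ j
      vanish refl = z≤n

    -- The left side is the change of the order of two tokens in the universal cover. When exactly
    -- one of them moves, `above` and `below` cancel the winding against the linear order; only the
    -- swapped pair itself can change, and by at most one, which is `between`.
    swap-bound : ∀ x y → ∣ (ω y - ω x) + (lt y x - lt (τ y) (τ x)) ∣ ≤ hit x y ℕ.+ hit y x
    swap-bound x y with spot u v x | spot u v y
    ... | at-u | at-u rewrite transpose-u u v | 𝟙-no (u <? u) (ℕ.n≮n _) | 𝟙-no (v <? v) (ℕ.n≮n _)
      = vanish (eq (ω u))
      where eq : ∀ a → (a - a) + 0ℤ ≡ 0ℤ
            eq = solve-∀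
    ... | at-v | at-v rewrite transpose-v u v | 𝟙-no (u <? u) (ℕ.n≮n _) | 𝟙-no (v <? v) (ℕ.n≮n _)
      = vanish (eq (ω v))
      where eq : ∀ a → (a - a) + 0ℤ ≡ 0ℤ
            eq = solve-∀
    ... | at-u | at-v rewrite transpose-u u v | transpose-v u v | ω-u | ω-v | δ-≡ u | δ-≡ v
      = ℕ.≤-trans between (ℕ.m≤m+n 1 _)
    ... | at-v | at-u rewrite transpose-u u v | transpose-v u v | ω-u | ω-v | δ-≡ u | δ-≡ v
      = ℕ.≤-trans (ℕ.≤-reflexive (trans (cong ∣_∣ (eq turn (lt v u) (lt u v))) (∣-i∣≡∣i∣ ((- turn - turn) + (lt v u - lt u v)))))
                  (ℕ.≤-trans between (ℕ.m≤n+m 1 _))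
      where eq : ∀ t a b → (t - - t) + (b - a) ≡ - ((- t - t) + (a - b))
            eq = solve-∀
    ... | at-u | off p q rewrite transpose-u u v | transpose-off u v p q | ω-u | ω-off p q
      = vanish (trans (cong (_+_ (0ℤ - turn)) (below p q)) (eq turn))
      where eq : ∀ t → (0ℤ - t) + t ≡ 0ℤ
            eq = solve-∀
    ... | off p q | at-u rewrite transpose-u u v | transpose-off u v p q | ω-u | ω-off p q
      = vanish (trans (eq turn (lt v x) (lt u x)) (trans (cong (_-_ turn) (above p q)) (+-inverseʳ turn)))
      where eq : ∀ t a b → (t - 0ℤ) + (b - a) ≡ t - (a - b)
            eq = solve-∀
    ... | at-v | off p q rewrite transpose-v u v | transpose-off u v p q | ω-v | ω-off p q
      = vanish (trans (eq turn (lt y u) (lt y v)) (trans (cong (_-_ turn) (below p q)) (+-inverseʳ turn)))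
      where eq : ∀ t a b → (0ℤ - - t) + (b - a) ≡ t - (a - b)
            eq = solve-∀
    ... | off p q | at-v rewrite transpose-v u v | transpose-off u v p q | ω-v | ω-off p q
      = vanish (trans (cong (_+_ (- turn - 0ℤ)) (above p q)) (eq turn))
      where eq : ∀ t → (- t - 0ℤ) + t ≡ 0ℤ
            eq = solve-∀
    ... | off p q | off p′ q′
      rewrite transpose-off u v p q | transpose-off u v p′ q′ | ω-off p q | ω-off p′ q′
      = vanish (trans (cong (0ℤ +_) (+-inverseʳ (lt y x))) refl)

  -- The tokens are lifted to the universal cover of the cycle: w counts full
  -- turns, crossed i j the swaps in which i and j pass each other, with i on
  -- the first end of the edge.
  record Crossings {n} (f g : Fin n → Fin n) (k : ℕ) : Set where
    field
      w           : Fin n → ℤ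
      crossed     : Fin n → Fin n → ℕ
      sum-w       : sumℤ w ≡ 0ℤ
      sum-crossed : sum (λ i → sum (crossed i)) ≡ k
      bound       : ∀ i j → ∣ (w j - w i) + (lt (f j) (f i) - lt (g j) (g i)) ∣
                            ≤ crossed i j ℕ.+ crossed j i

  -- The placement is taken to be a permutation so that sums over tokens can be reindexed by
  -- vertices; each swap then adds total winding zero and exactly one hit.
  crossings : ∀ {n} (π : Permutation′ (2 ℕ.+ n)) (es : List (Edge (cycle n))) →
              Crossings (π ⟨$⟩ʳ_) (foldl (swap {G = cycle n}) (π ⟨$⟩ʳ_) es) (length es)
  crossings {n} π [] = record
    { w           = λ _ → 0ℤ
    ; crossed     = λ _ _ → 0
    ; sum-w       = sumℤ-zero (2 ℕ.+ n)
    ; sum-crossed = trans (sum-cong-≗ {2 ℕ.+ n} (λ _ → sum-replicate-zero (2 ℕ.+ n))) (sum-replicate-zero (2 ℕ.+ n))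
    ; bound       = λ i j → ℕ.≤-reflexive (cong (λ a → ∣ 0ℤ + a ∣) (+-inverseʳ (lt (π ⟨$⟩ʳ j) (π ⟨$⟩ʳ i))))
    }
  crossings {n} π ((u , v , e) ∷ es) = record
    { w           = λ i → ω (f i) + w i
    ; crossed     = λ i j → hit (f i) (f j) ℕ.+ crossed i j
    ; sum-w       = begin
        sumℤ (λ i → ω (f i) + w i)       ≡⟨ ∑ℤ-distrib-+ (ω ∘ f) w ⟩
        sumℤ (ω ∘ f) + sumℤ w            ≡⟨ cong₂ _+_ (trans (sym (sumℤ-permute ω π)) sum-ω) sum-w ⟩
        0ℤ ∎
    ; sum-crossed = begin
        sum (λ i → sum (λ j → hit (f i) (f j) ℕ.+ crossed i j))
          ≡⟨ sum-cong-≗ (λ i → ∑-distrib-+ (hit (f i) ∘ f) (crossed i)) ⟩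
        sum (λ i → sum (hit (f i) ∘ f) ℕ.+ sum (crossed i))
          ≡⟨ ∑-distrib-+ (λ i → sum (hit (f i) ∘ f)) (λ i → sum (crossed i)) ⟩
        sum (λ i → sum (hit (f i) ∘ f)) ℕ.+ sum (λ i → sum (crossed i))
          ≡⟨ cong₂ ℕ._+_ hits sum-crossed ⟩
        suc (length es) ∎
    -- The change of order is split at the placement after the first swap; the triangle inequality
    -- combines `swap-bound` with the inductive bound.
    ; bound       = λ i j → ℕ.≤-trans
        (ℕ.≤-reflexive (cong ∣_∣ (telescope (ω (f i)) (ω (f j)) (w i) (w j)
          (lt (f j) (f i)) (lt (τ (f j)) (τ (f i))) (lt (g j) (g i)))))
        (ℕ.≤-trans (∣i+j∣≤∣i∣+∣j∣ (ω (f j) - ω (f i) + (lt (f j) (f i) - lt (τ (f j)) (τ (f i)))) _)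
        (ℕ.≤-trans (ℕ.+-mono-≤ (swap-bound (f i) (f j)) (bound i j))
        (ℕ.≤-reflexive (interchange (hit (f i) (f j)) _ (crossed i j) _))))
    }
    where
    open ≡-Reasoning
    f = π ⟨$⟩ʳ_
    g = foldl (swap {G = cycle n}) f ((u , v , e) ∷ es)
    open Swap (λ u≡v → Graph.∼-irrefl (cycle n) u≡v e) (edge-turn {n} e)
    -- `∘ₚ` applies its left argument first, so this is the placement after the swap.
    open Crossings (crossings (π ∘ₚ Perm.transpose u v) es)
    hits : sum (λ i → sum (hit (f i) ∘ f)) ≡ 1
    hits = begin
      sum (λ i → sum (hit (f i) ∘ f)) ≡⟨ sum-cong-≗ (λ i → sum-permute (hit (f i)) π) ⟨
      sum (λ i → sum (hit (f i)))     ≡⟨ sum-permute (λ x → sum (hit x)) π ⟨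
      sum (λ x → sum (hit x))         ≡⟨ sum-hit ⟩
      1 ∎
    telescope : ∀ a b c d p q r → (b + d - (a + c)) + (p - r) ≡ ((b - a) + (p - q)) + ((d - c) + (q - r))
    telescope = solve-∀
    interchange : ∀ a b c d → (a ℕ.+ b) ℕ.+ (c ℕ.+ d) ≡ (a ℕ.+ c) ℕ.+ (b ℕ.+ d)
    interchange = ℕ-solve-∀

-- Lower bounds for double sums from disjoint cells.

module Summation where
  open import Data.Fin using (Fin; zero; suc; punchIn; combine; _↑ˡ_; _↑ʳ_)
  open import Data.Fin.Properties using (punchInᵢ≢i; punchIn-injective)
  open import Data.Nat using (ℕ; zero; suc; _+_; _*_; _≤_; z≤n)
  open import Data.Nat.Properties
  open import Algebra.Properties.Semiring.Sum +-*-semiring using (sum; sum-cong-≗)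
  open import Algebra.Properties.CommutativeMonoid.Sum +-0-commutativeMonoid using (sum-remove; ∑-distrib-+)
  open import Relation.Binary.PropositionalEquality using (_≡_; _≢_; refl; sym; trans; cong)
  open import Function using (_∘_)

  sum-mono : ∀ {n} {f g : Fin n → ℕ} → (∀ i → f i ≤ g i) → sum f ≤ sum g
  sum-mono {zero}  f≤g = z≤n
  sum-mono {suc n} f≤g = +-mono-≤ (f≤g zero) (sum-mono (f≤g ∘ suc))

  sum-const-≤ : ∀ {n b} {f : Fin n → ℕ} → (∀ i → b ≤ f i) → n * b ≤ sum f
  sum-const-≤ {zero}  b≤f = z≤n
  sum-const-≤ {suc n} b≤f = +-mono-≤ (b≤f zero) (sum-const-≤ (b≤f ∘ suc))

  sum-≤-const : ∀ {n b} {f : Fin n → ℕ} → (∀ i → f i ≤ b) → sum f ≤ n * b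
  sum-≤-const {zero}  f≤b = z≤n
  sum-≤-const {suc n} f≤b = +-mono-≤ (f≤b zero) (sum-≤-const (f≤b ∘ suc))

  term≤sum : ∀ {n} (f : Fin n → ℕ) i → f i ≤ sum f
  term≤sum {suc n} f zero    = m≤m+n (f zero) _
  term≤sum {suc n} f (suc i) = ≤-trans (term≤sum (f ∘ suc) i) (m≤n+m _ (f zero))

  sum-↑ : ∀ m {n} (f : Fin (m + n) → ℕ) → sum f ≡ sum (λ i → f (i ↑ˡ n)) + sum (λ j → f (m ↑ʳ j))
  sum-↑ zero    f = refl
  sum-↑ (suc m) f = trans (cong (f zero +_) (sum-↑ m (f ∘ suc))) (sym (+-assoc (f zero) _ _))

  sum-combine : ∀ m {n} (f : Fin (m * n) → ℕ) → sum f ≡ sum (λ i → sum (λ j → f (combine {m} i j)))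
  sum-combine zero        f = refl
  sum-combine (suc m) {n} f =
    trans (sum-↑ n f) (cong (sum (λ j → f (j ↑ˡ (m * n))) +_) (sum-combine m (λ j → f (n ↑ʳ j))))

  -- Two distinct indices are encoded as `i` and `punchIn i j`; this enumerates all the remaining
  -- ones.
  others : ∀ {n} → Fin (2 + n) → Fin (1 + n) → Fin n → Fin (2 + n)
  others i j k = punchIn i (punchIn j k)

  sum-remove₂ : ∀ {n} (f : Fin (2 + n) → ℕ) i j →
                sum f ≡ f i + (f (punchIn i j) + sum (f ∘ others i j))
  sum-remove₂ f i j =
    trans (sum-remove {i = i} f) (cong (f i +_) (sum-remove {i = j} (f ∘ punchIn i)))

  -- Each index `k` other than the two distinguished ones owns five cells: those joining it to `i`
  -- and `i′` in both directions, and its diagonal cell. Different `k` own disjoint cells.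
  sum-sum-≥ : ∀ {n b} (F : Fin (2 + n) → Fin (2 + n) → ℕ) i j → let i′ = punchIn i j in
              (∀ k → k ≢ i → k ≢ i′ → b ≤ (F k i + F i k) + (F k i′ + F i′ k) + F k k) →
              n * b ≤ sum (λ k → sum (F k))
  sum-sum-≥ {n} {b} F i j b≤ = begin
    n * b
      ≤⟨ sum-const-≤ (λ k → b≤ (o k) (punchInᵢ≢i i _) (punchInᵢ≢i j k ∘ punchIn-injective i _ _)) ⟩
    sum (λ k → (F (o k) i + F i (o k)) + (F (o k) i′ + F i′ (o k)) + F (o k) (o k))
      ≤⟨ sum-mono (λ k → regroup (F (o k) i) (F i (o k)) (F (o k) i′) (F i′ (o k)) (row k)) ⟩
    sum (λ k → F i (o k) + (F i′ (o k) + sum (F (o k))))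
      ≡⟨ ∑-distrib-+ (F i ∘ o) (λ k → F i′ (o k) + sum (F (o k))) ⟩
    sum (F i ∘ o) + sum (λ k → F i′ (o k) + sum (F (o k)))
      ≡⟨ cong (sum (F i ∘ o) +_) (∑-distrib-+ (F i′ ∘ o) (λ k → sum (F (o k)))) ⟩
    sum (F i ∘ o) + (sum (F i′ ∘ o) + sum (λ k → sum (F (o k))))
      ≤⟨ +-mono-≤ (rest (F i)) (+-monoˡ-≤ (sum (λ k → sum (F (o k)))) (rest (F i′))) ⟩
    sum (F i) + (sum (F i′) + sum (λ k → sum (F (o k))))
      ≡⟨ sum-remove₂ (λ k → sum (F k)) i j ⟨
    sum (λ k → sum (F k)) ∎
    where
    open ≤-Reasoning
    i′ = punchIn i j
    o = others i j
    rest : ∀ f → sum (f ∘ o) ≤ sum f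
    rest f = begin
      sum (f ∘ o)                ≤⟨ m≤n+m _ (f i′) ⟩
      f i′ + sum (f ∘ o)         ≤⟨ m≤n+m _ (f i) ⟩
      f i + (f i′ + sum (f ∘ o)) ≡⟨ sum-remove₂ f i j ⟨
      sum f ∎
    row : ∀ k → F (o k) i + (F (o k) i′ + F (o k) (o k)) ≤ sum (F (o k))
    row k = begin
      F (o k) i + (F (o k) i′ + F (o k) (o k))
        ≤⟨ +-monoʳ-≤ (F (o k) i) (+-monoʳ-≤ (F (o k) i′) (term≤sum (F (o k) ∘ o) k)) ⟩
      F (o k) i + (F (o k) i′ + sum (F (o k) ∘ o))
        ≡⟨ sum-remove₂ (F (o k)) i j ⟨
      sum (F (o k)) ∎
    regroup : ∀ a b c d {e s} → a + (c + e) ≤ s → (a + b) + (c + d) + e ≤ b + (d + s)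
    regroup a b c d {e} {s} le = begin
      (a + b) + (c + d) + e   ≡⟨ shuffle a b c d e ⟩
      b + (d + (a + (c + e))) ≤⟨ +-monoʳ-≤ b (+-monoʳ-≤ d le) ⟩
      b + (d + s) ∎
      where
      open import Data.Nat.Tactic.RingSolver
      shuffle : ∀ a b c d e → (a + b) + (c + d) + e ≡ b + (d + (a + (c + e)))
      shuffle = solve-∀

  -- The cells selected are disjoint: column `j`, the rest of row zero, and one cell outside column
  -- `j` in each further row. Column `j` will belong to t₀, the other columns to third tokens, one
  -- for each stationary token of a block.
  sum-column-diagonal : ∀ {n} (Y : Fin (suc n) → Fin (suc n) → ℕ) j →
    sum (λ i → Y i j) + sum (λ k → Y zero (punchIn j k) + Y (suc k) (punchIn j k))
    ≤ sum (λ i → sum (Y i))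
  sum-column-diagonal {n} Y j = begin
    sum (λ i → Y i j) + sum (λ k → Y zero (p k) + Y (suc k) (p k))
      ≡⟨ cong (sum (λ i → Y i j) +_) (∑-distrib-+ (Y zero ∘ p) (λ k → Y (suc k) (p k))) ⟩
    sum (λ i → Y i j) + (sum (Y zero ∘ p) + sum (λ k → Y (suc k) (p k)))
      ≤⟨ +-monoʳ-≤ (sum (λ i → Y i j)) (+-monoʳ-≤ (sum (Y zero ∘ p)) (sum-mono λ k → term≤sum (Y (suc k) ∘ p) k)) ⟩
    sum (λ i → Y i j) + sum (λ i → sum (Y i ∘ p))
      ≡⟨ ∑-distrib-+ (λ i → Y i j) (λ i → sum (Y i ∘ p)) ⟨
    sum (λ i → Y i j + sum (Y i ∘ p))
      ≡⟨ sum-cong-≗ (λ i → sum-remove {i = j} (Y i)) ⟨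
    sum (λ i → sum (Y i)) ∎
    where
    open ≤-Reasoning
    p = punchIn j

-- Crossings forced by each block.

module Blocks where
  open import Data.Fin using (Fin; zero; suc; punchIn)
  open import Data.Integer as ℤ using (ℤ; ∣_∣; _-_; 1ℤ)
  import Data.Integer.Properties as ℤ
  open import Data.Nat using (ℕ; zero; suc; _+_; _*_; _≤_)
  open import Data.Nat.Properties
  open import Algebra.Properties.Semiring.Sum +-*-semiring using (sum; sum-cong-≗)
  open import Algebra.Properties.CommutativeMonoid.Sum +-0-commutativeMonoid using (∑-distrib-+; ∑-comm)
  open import Relation.Binary.PropositionalEquality using (_≡_; _≢_; cong; cong₂)
  open import Function using (_∘_)
  open Summation

  ≢⇒1≤∣-∣ : ∀ {i j : ℤ} → i ≢ j → 1 ≤ ∣ i - j ∣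
  ≢⇒1≤∣-∣ {i} {j} i≢j = n≢0⇒n>0 (i≢j ∘ ℤ.i-j≡0⇒i≡j i j ∘ ℤ.∣i∣≡0⇒i≡0)

  apart : ∀ {i j} k → i ≢ j → 1 ≤ ∣ i - k ∣ + ∣ j - k ∣
  apart {i} {j} k i≢j = begin
    1                         ≤⟨ ≢⇒1≤∣-∣ i≢j ⟩
    ∣ i - j ∣                 ≡⟨ cong ∣_∣ (eq i j k) ⟩
    ∣ (i - k) - (j - k) ∣     ≤⟨ ℤ.∣i-j∣≤∣i∣+∣j∣ (i - k) (j - k) ⟩
    ∣ i - k ∣ + ∣ j - k ∣     ∎
    where
    open ≤-Reasoning
    open import Data.Integer.Tactic.RingSolver
    eq : ∀ i j k → i - j ≡ (i - k) - (j - k)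
    eq = solve-∀

  -- If the last term vanishes, then `i` and `j` differ, so `x` cannot equal both. Here `i` is the
  -- mover, `j` a stationary token of its block and `x` the third token.
  triangle : ∀ x i j → 1 ≤ (∣ x - i ∣ + ∣ x - j ∣) + ∣ j - i - 1ℤ ∣
  triangle x i j = begin
    1                                          ≡⟨ cong ∣_∣ (eq x i j) ⟩
    ∣ (x - i) - (x - j) - (j - i - 1ℤ) ∣       ≤⟨ ℤ.∣i-j∣≤∣i∣+∣j∣ ((x - i) - (x - j)) (j - i - 1ℤ) ⟩
    ∣ (x - i) - (x - j) ∣ + ∣ j - i - 1ℤ ∣     ≤⟨ +-monoˡ-≤ _ (ℤ.∣i-j∣≤∣i∣+∣j∣ (x - i) (x - j)) ⟩
    (∣ x - i ∣ + ∣ x - j ∣) + ∣ j - i - 1ℤ ∣   ∎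
    where
    open ≤-Reasoning
    open import Data.Integer.Tactic.RingSolver
    eq : ∀ x i j → 1ℤ ≡ (x - i) - (x - j) - (j - i - 1ℤ)
    eq = solve-∀

  -- Blocks have `suc l` tokens here; `a` is the winding relative to the rotation and `X` counts
  -- crossings. The 1 in `near` is the overtaking of a stationary token by the mover of its block
  -- that the rotation prescribes.
  module _ {m l} (a : Fin (2 + m) → Fin (suc l) → ℤ)
    (X : Fin (2 + m) → Fin (suc l) → Fin (2 + m) → Fin (suc l) → ℕ)
    (far  : ∀ {s s′} → s ≢ s′ → ∀ r r′ → ∣ a s′ r′ - a s r ∣ ≤ X s r s′ r′ + X s′ r′ s r)
    (near : ∀ s r → ∣ a s (suc r) - a s zero - 1ℤ ∣ ≤ X s zero s (suc r) + X s (suc r) s zero)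
    where

    between : Fin (2 + m) → Fin (2 + m) → ℕ
    between s s′ = sum λ r → sum (X s r s′)

    gap : Fin (2 + m) → Fin (suc l) → Fin (2 + m) → Fin (suc l) → ℕ
    gap s r s′ r′ = ∣ a s′ r′ - a s r ∣

    gap≤between : ∀ {s s′} → s ≢ s′ →
                  sum (λ r → sum (gap s r s′)) ≤ between s s′ + between s′ s
    gap≤between {s} {s′} s≢s′ = begin
      sum (λ r → sum (gap s r s′))
        ≤⟨ sum-mono (λ r → sum-mono (far s≢s′ r)) ⟩
      sum (λ r → sum (λ r′ → X s r s′ r′ + X s′ r′ s r))
        ≡⟨ sum-cong-≗ (λ r → ∑-distrib-+ (X s r s′) (λ r′ → X s′ r′ s r)) ⟩
      sum (λ r → sum (X s r s′) + sum (λ r′ → X s′ r′ s r))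
        ≡⟨ ∑-distrib-+ (λ r → sum (X s r s′)) (λ r → sum (λ r′ → X s′ r′ s r)) ⟩
      between s s′ + sum (λ r → sum (λ r′ → X s′ r′ s r))
        ≡⟨ cong (between s s′ +_) (∑-comm (λ r r′ → X s′ r′ s r)) ⟩
      between s s′ + between s′ s ∎
      where open ≤-Reasoning

    within : ∀ s → sum (λ q → ∣ a s (suc q) - a s zero - 1ℤ ∣) ≤ between s s
    within s = begin
      sum (λ q → ∣ a s (suc q) - a s zero - 1ℤ ∣)
        ≤⟨ sum-mono (near s) ⟩
      sum (λ q → X s zero s (suc q) + X s (suc q) s zero)
        ≡⟨ ∑-distrib-+ (λ q → X s zero s (suc q)) (λ q → X s (suc q) s zero) ⟩
      sum (λ q → X s zero s (suc q)) + sum (λ q → X s (suc q) s zero)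
        ≤⟨ +-mono-≤ (m≤n+m _ (X s zero s zero)) (sum-mono λ q → term≤sum (X s (suc q) s) zero) ⟩
      between s s ∎
      where open ≤-Reasoning

    module _ {s₀ s₁ r₀ r₁} (differ : a s₀ r₀ ≢ a (punchIn s₀ s₁) r₁) where
      private s₁′ = punchIn s₀ s₁

      -- The first summand comes from `apart`: every token of the block differs in `a` from t₀ or
      -- t₁. The second comes from `triangle`, where the third token for the stationary token
      -- `suc q` is number `punchIn r₀ q` of block `s₀`: never t₀, and different for different `q`,
      -- so no crossing is counted twice.
      block : ∀ s → s ≢ s₀ → s ≢ s₁′ →
              suc l * 1 + l * 1 ≤
              (between s s₀ + between s₀ s) + (between s s₁′ + between s₁′ s) + between s s
      block s s≢s₀ s≢s₁ = begin
        suc l * 1 + l * 1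
          ≤⟨ +-mono-≤ (sum-const-≤ {f = λ r → g₀ r + g₁ r} λ r → apart (a s r) differ)
                      (sum-const-≤ {f = λ q → t q + z q} λ q → triangle (a s₀ (punchIn r₀ q)) (a s zero) (a s (suc q))) ⟩
        sum (λ r → g₀ r + g₁ r) + sum (λ q → t q + z q)
          ≡⟨ cong₂ _+_ (∑-distrib-+ g₀ g₁) (∑-distrib-+ t z) ⟩
        (sum g₀ + sum g₁) + (sum t + sum z)
          ≡⟨ shuffle (sum g₀) (sum g₁) (sum t) (sum z) ⟩
        (sum g₀ + sum t) + sum g₁ + sum z
          ≤⟨ +-mono-≤ (+-mono-≤
               (≤-trans (sum-column-diagonal (λ r → gap s r s₀) r₀) (gap≤between s≢s₀))
               (≤-trans (sum-mono λ r → term≤sum (gap s r s₁′) r₁) (gap≤between s≢s₁)))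
               (within s) ⟩
        (between s s₀ + between s₀ s) + (between s s₁′ + between s₁′ s) + between s s ∎
        where
        open ≤-Reasoning
        open import Data.Nat.Tactic.RingSolver
        shuffle : ∀ a b c d → (a + b) + (c + d) ≡ (a + c) + b + d
        shuffle = solve-∀
        g₀ g₁ : Fin (suc l) → ℕ
        g₀ r = gap s r s₀ r₀
        g₁ r = gap s r s₁′ r₁
        t z : Fin l → ℕ
        t q = gap s zero s₀ (punchIn r₀ q) + gap s (suc q) s₀ (punchIn r₀ q)
        z q = ∣ a s (suc q) - a s zero - 1ℤ ∣

      blocks : m * (suc l + l) ≤ sum (λ s → sum (λ r → sum (λ s′ → sum (X s r s′))))
      blocks = begin
        m * (suc l + l)
          ≡⟨ cong (m *_) (cong₂ _+_ (*-identityʳ (suc l)) (*-identityʳ l)) ⟨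
        m * (suc l * 1 + l * 1)
          ≤⟨ sum-sum-≥ between s₀ s₁ block ⟩
        sum (λ s → sum (λ s′ → sum (λ r → sum (X s r s′))))
          ≡⟨ sum-cong-≗ (λ s → ∑-comm (λ s′ r → sum (X s r s′))) ⟩
        sum (λ s → sum (λ r → sum (λ s′ → sum (X s r s′)))) ∎
        where open ≤-Reasoning

-- The rotation instance.

module Configuration where
  open import Data.Fin using (Fin; zero; suc; toℕ; fromℕ; fromℕ<; combine; remQuot; punchIn; _<_; _≤_)
  open import Data.Fin.Properties as Fin
    using (toℕ-fromℕ; toℕ-fromℕ<; toℕ-combine; toℕ≤pred[n]; toℕ-injective; remQuot-combine;
      combine-remQuot; combine-injective; combine-injectiveˡ; combine-injectiveʳ; combine-monoˡ-<;
      any?; <-cmp; _<?_)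
  import Data.Fin.Permutation as Perm
  open import Data.Integer as ℤ using (ℤ; 0ℤ; 1ℤ; ∣_∣; _-_; _+_)
  import Data.Integer.Properties as ℤ
  open import Data.Nat as ℕ using (ℕ; zero; suc; s≤s; z≤n)
  import Data.Nat.Properties as ℕ
  open import Data.Product using (Σ-syntax; ∃-syntax; _×_; _,_; proj₁; proj₂; uncurry)
  open import Function using (_∘_; id; mk↣; Injective)
  open import Relation.Binary using (tri<; tri≈; tri>)
  open import Relation.Binary.PropositionalEquality
    using (_≡_; _≢_; refl; sym; trans; cong; cong₂; subst; subst₂; _≗_; module ≡-Reasoning)
  open import Relation.Nullary using (yes; no; ¬_; contradiction)
  open import Relation.Nullary.Decidable using (decidable-stable; ¬?)
  open import Algebra.Properties.Semiring.Sum ℕ.+-*-semiring using (sum; sum-cong-≗; sum-replicate-zero)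
  open import Algebra.Properties.Semiring.Sum ℤ.+-*-semiring
    renaming (sum to sumℤ; sum-cong-≗ to sumℤ-cong) using ()
  open import Algebra.Properties.CommutativeMonoid.Sum ℤ.+-0-commutativeMonoid
    renaming (∑-distrib-+ to ∑ℤ-distrib-+) using ()
  open Search
  open Routing
  open Cycle
  open Indicator
  open Kronecker ℤ.+-*-semiring
  open Crossing using (lt; Crossings; crossings)
  open Summation
  open Blocks

  cyc : ∀ {m} → Fin (suc m) → Fin (suc m)
  cyc {m} s with suc (toℕ s) ℕ.<? suc m
  ... | yes 1+s<1+m = fromℕ< 1+s<1+m
  ... | no  _       = zero

  data Next {m} (s c : Fin (suc m)) : Set where
    wrap : s ≡ fromℕ m → c ≡ zero → Next s c
    next : s ≢ fromℕ m → toℕ c ≡ suc (toℕ s) → Next s c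

  cyc-next : ∀ {m} (s : Fin (suc m)) → Next s (cyc s)
  cyc-next {m} s with suc (toℕ s) ℕ.<? suc m
  ... | yes 1+s<1+m = next
    (λ { refl → ℕ.<⇒≢ (ℕ.s<s⁻¹ 1+s<1+m) (toℕ-fromℕ m) }) (toℕ-fromℕ< 1+s<1+m)
  ... | no 1+s≮1+m = wrap
    (toℕ-injective (trans (ℕ.≤-antisym (toℕ≤pred[n] s) (ℕ.≮⇒≥ (1+s≮1+m ∘ s≤s))) (sym (toℕ-fromℕ m))))
    refl

  cyc-injective : ∀ {m} {s s′ : Fin (suc m)} → cyc s ≡ cyc s′ → s ≡ s′
  cyc-injective {s = s} {s′} eq with cyc-next s | cyc-next s′
  ... | wrap p _ | wrap p′ _ = trans p (sym p′)
  ... | wrap _ c | next _ c′ = contradiction (trans (cong toℕ (trans (sym c) eq)) c′) λ ()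
  ... | next _ c | wrap _ c′ = contradiction (trans (cong toℕ (trans (sym c′) (sym eq))) c) λ ()
  ... | next _ c | next _ c′ = toℕ-injective (ℕ.suc-injective (trans (sym c) (trans (cong toℕ eq) c′)))

  combine-mono-≤-< : ∀ {m n} {i i′ : Fin m} {j j′ : Fin n} → i ≤ i′ → j < j′ → combine i j < combine i′ j′
  combine-mono-≤-< {n = n} {i} {i′} {j} {j′} i≤i′ j<j′ =
    subst₂ ℕ._<_ (sym (toℕ-combine i j)) (sym (toℕ-combine i′ j′))
           (ℕ.+-mono-≤-< (ℕ.*-monoʳ-≤ n i≤i′) j<j′)

  sumℤ-const : ∀ n i → sumℤ {n} (λ _ → i) ≡ ℤ.+ n ℤ.* i
  sumℤ-const zero    i = refl
  sumℤ-const (suc n) i = trans (cong (i +_) (sumℤ-const n i)) (sym (ℤ.suc-* (ℤ.+ n) i))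

  module _ (p l : ℕ) where

    private
      M = 2 ℕ.+ p
      L = 2 ℕ.+ l
      N = M ℕ.* L
      -- Chosen so that `N` is `2 + n` by computation, as `cycle n` has `2 + n` vertices.
      n = l ℕ.+ suc p ℕ.* L

    shift : Fin M → Fin L → Fin N
    shift s zero    = combine {n = L} (cyc s) zero
    shift s (suc r) = combine s (suc r)

    shift-injective : ∀ {s s′ r r′} → shift s r ≡ shift s′ r′ → s ≡ s′ × r ≡ r′
    shift-injective {s} {s′} {zero}  {zero}   eq = cyc-injective (combine-injectiveˡ {n = L} (cyc s) zero (cyc s′) zero eq) , refl
    shift-injective {s} {s′} {zero}  {suc r′} eq with () ← combine-injectiveʳ {n = L} (cyc s) zero s′ (suc r′) eq
    shift-injective {s} {s′} {suc r} {zero}   eq with () ← combine-injectiveʳ {n = L} s (suc r) (cyc s′) zero eq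
    shift-injective {s} {s′} {suc r} {suc r′} eq = combine-injective s (suc r) s′ (suc r′) eq

    σ : Fin N → Fin N
    σ t = uncurry shift (remQuot {M} L t)

    σ-combine : ∀ s r → σ (combine s r) ≡ shift s r
    σ-combine s r = cong (uncurry shift) (remQuot-combine s r)

    σ-injective : Injective _≡_ _≡_ σ
    σ-injective {x} {y} eq = begin
      x                                    ≡⟨ combine-remQuot {M} L x ⟨
      uncurry combine (remQuot {M} L x)    ≡⟨ cong₂ (combine {M} {L}) (proj₁ same) (proj₂ same) ⟩
      uncurry combine (remQuot {M} L y)    ≡⟨ combine-remQuot {M} L y ⟩
      y ∎
      where
      open ≡-Reasoning
      same = shift-injective {proj₁ (remQuot {M} L x)} {proj₁ (remQuot {M} L y)} {proj₂ (remQuot {M} L x)} eq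

    top : Fin N
    top = combine {n = L} (fromℕ (suc p)) zero

    -- The winding numbers of the rotation itself: only the mover of the last
    -- block passes from vertex N - 1 to vertex 0.
    κ : Fin N → ℤ
    κ = δ top

    κ-s : ∀ {s} r → s ≢ fromℕ (suc p) → κ (combine s r) ≡ 0ℤ
    κ-s {s} r s≢ = δ-≢ (s≢ ∘ combine-injectiveˡ {n = L} s r (fromℕ (suc p)) zero)

    κ-r : ∀ s r → κ (combine s (suc r)) ≡ 0ℤ
    κ-r s r = δ-≢ λ eq → contradiction (combine-injectiveʳ {n = L} s (suc r) (fromℕ (suc p)) zero eq) λ ()

    -- For tokens of blocks `s < s′`, only the later one can wrap around, so its `κ` tells whether
    -- the linear order gets reversed.
    data Order (s s′ : Fin M) (r r′ : Fin L) : Set where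
      kept     : shift s r < shift s′ r′ → κ (combine s′ r′) ≡ 0ℤ → Order s s′ r r′
      reversed : shift s′ r′ < shift s r → κ (combine s′ r′) ≡ 1ℤ → Order s s′ r r′

    <⇒≢top : ∀ {s s′ : Fin M} → s < s′ → s ≢ fromℕ (suc p)
    <⇒≢top {s′ = s′} s<s′ refl = ℕ.<⇒≱ s<s′ (subst (toℕ s′ ℕ.≤_) (sym (toℕ-fromℕ (suc p))) (toℕ≤pred[n] s′))

    -- A mover stops on the first vertex of the next block, which is vacated by that block's own
    -- mover. It therefore passes no token of another block, and only the wrap to vertex 0 reverses
    -- an order.
    order : ∀ {s s′} → s < s′ → ∀ r r′ → Order s s′ r r′
    order {s} {s′} s<s′ zero zero with cyc-next s | cyc-next s′
    ... | wrap s≡top _ | _ = contradiction s≡top (<⇒≢top s<s′)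
    ... | next _ c | next s′≢top c′ = kept
      (combine-monoˡ-< {n = L} zero zero (subst₂ ℕ._<_ (sym c) (sym c′) (s≤s s<s′)))
      (κ-s zero s′≢top)
    ... | next _ c | wrap refl c′ = reversed
      (combine-monoˡ-< {n = L} zero zero (subst₂ ℕ._<_ (sym (cong toℕ c′)) (sym c) (s≤s z≤n)))
      (δ-≡ top)
    order {s} {s′} s<s′ (suc r) zero with cyc-next s′
    ... | next s′≢top c′ = kept
      (combine-monoˡ-< {n = L} (suc r) zero (subst (toℕ s ℕ.<_) (sym c′) (ℕ.m<n⇒m<1+n s<s′)))
      (κ-s zero s′≢top)
    ... | wrap refl c′ = reversed
      (combine-mono-≤-< {i = cyc s′} {s} {zero} {suc r} (subst (ℕ._≤ toℕ s) (sym (cong toℕ c′)) z≤n) (s≤s z≤n))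
      (δ-≡ top)
    order {s} {s′} s<s′ zero (suc r′) with cyc-next s
    ... | wrap s≡top _ = contradiction s≡top (<⇒≢top s<s′)
    ... | next _ c = kept
      (combine-mono-≤-< {i = cyc s} {s′} {zero} {suc r′} (subst (ℕ._≤ toℕ s′) (sym c) s<s′) (s≤s z≤n))
      (κ-r s′ r′)
    order {s} {s′} s<s′ (suc r) (suc r′) = kept (combine-monoˡ-< (suc r) (suc r′) s<s′) (κ-r s′ r′)

    order-lt : ∀ {s s′} → s < s′ → ∀ r r′ →
               lt (shift s′ r′) (shift s r) ≡ κ (combine s′ r′) ×
               lt (shift s r) (shift s′ r′) ≡ 1ℤ - κ (combine s′ r′)
    order-lt {s} {s′} s<s′ r r′ with order s<s′ r r′
    ... | kept     x κ≡0 rewrite κ≡0 =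
      𝟙-no (shift s′ r′ <? shift s r) (ℕ.<-asym x) , 𝟙-yes (shift s r <? shift s′ r′) x
    ... | reversed x κ≡1 rewrite κ≡1 =
      𝟙-yes (shift s′ r′ <? shift s r) x , 𝟙-no (shift s r <? shift s′ r′) (ℕ.<-asym x)

    -- A mover ends above the stationary tokens of its block, except in the last block, where the
    -- wrap puts it below them and `κ` makes up for it.
    lt-overtaken : ∀ s r → lt (shift s (suc r)) (shift s zero) ≡ 1ℤ - κ (combine {n = L} s zero)
    lt-overtaken s r with cyc-next s
    ... | next s≢top c rewrite κ-s {s} zero s≢top =
      𝟙-yes (shift s (suc r) <? shift s zero) (combine-monoˡ-< {n = L} (suc r) zero (ℕ.≤-reflexive (sym c)))
    ... | wrap refl c rewrite δ-≡ top =
      𝟙-no (shift s (suc r) <? shift s zero)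
           (ℕ.<-asym (combine-mono-≤-< {i = cyc s} {s} {zero} {suc r}
                       (subst (ℕ._≤ toℕ s) (sym (cong toℕ c)) z≤n) (s≤s z≤n)))

    -- The lower bound on the number of swaps.

    module _ {g k} (g≗σ : g ≗ σ) (C : Crossings id g k) where
      open Crossings C

      -- Winding in excess of that of the rotation; it would be constant if all tokens followed the
      -- rotation up to a common number of full turns.
      a : Fin M → Fin L → ℤ
      a s r = w (combine s r) - κ (combine s r)

      X : Fin M → Fin L → Fin M → Fin L → ℕ
      X s r s′ r′ = crossed (combine s r) (combine s′ r′)

      bound-shift : ∀ s r s′ r′ →
        ∣ (w (combine s′ r′) - w (combine s r)) +
          (lt (combine s′ r′) (combine s r) - lt (shift s′ r′) (shift s r)) ∣ ℕ.≤ X s r s′ r′ ℕ.+ X s′ r′ s r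
      bound-shift s r s′ r′ = subst₂
        (λ y x → ∣ (w j - w i) + (lt j i - lt y x) ∣ ℕ.≤ X s r s′ r′ ℕ.+ X s′ r′ s r)
        (trans (g≗σ j) (σ-combine s′ r′)) (trans (g≗σ i) (σ-combine s r)) (bound i j)
        where
        i = combine s r
        j = combine s′ r′

      -- By `order-lt` the change of linear order between start and target is the `κ` of the token
      -- in the later block; the other `κ` is zero, since its block is not the last. The correction
      -- in `bound` thus turns `w` into `a`.
      far : ∀ {s s′} → s ≢ s′ → ∀ r r′ → ∣ a s′ r′ - a s r ∣ ℕ.≤ X s r s′ r′ ℕ.+ X s′ r′ s r
      far {s} {s′} s≢s′ r r′ = subst (ℕ._≤ X s r s′ r′ ℕ.+ X s′ r′ s r) (cong ∣_∣ value) (bound-shift s r s′ r′)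
        where
        i = combine s r
        j = combine s′ r′
        open import Data.Integer.Tactic.RingSolver
        forward : ∀ wᵢ wⱼ κⱼ → (wⱼ - wᵢ) + (0ℤ - κⱼ) ≡ (wⱼ - κⱼ) - (wᵢ - 0ℤ)
        forward = solve-∀
        backward : ∀ wᵢ wⱼ κᵢ → (wⱼ - wᵢ) + (1ℤ - (1ℤ - κᵢ)) ≡ (wⱼ - 0ℤ) - (wᵢ - κᵢ)
        backward = solve-∀
        value : (w j - w i) + (lt j i - lt (shift s′ r′) (shift s r)) ≡ a s′ r′ - a s r
        value with <-cmp s s′
        ... | tri≈ _ s≡s′ _ = contradiction s≡s′ s≢s′
        ... | tri< s<s′ _ _
          rewrite 𝟙-no (j <? i) (ℕ.<-asym (combine-monoˡ-< r r′ s<s′))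
                | proj₁ (order-lt s<s′ r r′)
                | κ-s r (<⇒≢top s<s′) = forward (w i) (w j) (κ j)
        ... | tri> _ _ s′<s
          rewrite 𝟙-yes (j <? i) (combine-monoˡ-< r′ r s′<s)
                | proj₂ (order-lt s′<s r′ r)
                | κ-s r′ (<⇒≢top s′<s) = backward (w i) (w j) (κ i)

      -- The mover starts below the other token and, by `lt-overtaken`, ends above it up to `κ`;
      -- this accounts for the 1.
      near : ∀ s r → ∣ a s (suc r) - a s zero - 1ℤ ∣ ℕ.≤ X s zero s (suc r) ℕ.+ X s (suc r) s zero
      near s r = subst (ℕ._≤ X s zero s (suc r) ℕ.+ X s (suc r) s zero) (cong ∣_∣ value) (bound-shift s zero s (suc r))
        where
        i = combine {n = L} s zero
        j = combine s (suc r)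
        open import Data.Integer.Tactic.RingSolver
        eq : ∀ wᵢ wⱼ κᵢ → (wⱼ - wᵢ) + (0ℤ - (1ℤ - κᵢ)) ≡ (wⱼ - 0ℤ) - (wᵢ - κᵢ) - 1ℤ
        eq = solve-∀
        value : (w j - w i) + (lt j i - lt (shift s (suc r)) (shift s zero)) ≡ a s (suc r) - a s zero - 1ℤ
        value rewrite 𝟙-no (j <? i) (ℕ.<-asym (combine-mono-≤-< {i = s} {s} {zero} {suc r} ℕ.≤-refl (s≤s z≤n)))
                    | lt-overtaken s r | κ-r s r = eq (w i) (w j) (κ i)

      -- The `w` sum to 0 and the `κ` to 1, so a constant `α` would satisfy N α = -1, which is
      -- impossible for N > 1.
      a-not-constant : ∀ α → ¬ (∀ s r → a s r ≡ α)
      a-not-constant α a≡α = contradiction (ℕ.m*n≡1⇒m≡1 N ∣ α ∣ N∣α∣≡1) λ ()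
        where
        open ≡-Reasoning
        open import Data.Integer.Tactic.RingSolver
        restore : ∀ i j → i ≡ (i - j) + j
        restore = solve-∀
        w≡ : ∀ t → w t ≡ α + κ t
        w≡ t with s , r ← remQuot {M} L t in eq
             with refl ← trans (cong (uncurry combine) (sym eq)) (combine-remQuot {M} L t) = begin
          w (combine s r)                               ≡⟨ restore (w (combine s r)) (κ (combine s r)) ⟩
          a s r + κ (combine s r)                       ≡⟨ cong (_+ κ (combine s r)) (a≡α s r) ⟩
          α + κ (combine s r) ∎
        Nα+1≡0 : ℤ.+ N ℤ.* α + 1ℤ ≡ 0ℤ
        Nα+1≡0 = begin
          ℤ.+ N ℤ.* α + 1ℤ              ≡⟨ cong₂ _+_ (sumℤ-const N α) (sum-δ top) ⟨
          sumℤ {N} (λ _ → α) + sumℤ κ   ≡⟨ ∑ℤ-distrib-+ (λ _ → α) κ ⟨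
          sumℤ (λ t → α + κ t)          ≡⟨ sumℤ-cong w≡ ⟨
          sumℤ w                        ≡⟨ sum-w ⟩
          0ℤ ∎
        N∣α∣≡1 : N ℕ.* ∣ α ∣ ≡ 1
        N∣α∣≡1 = begin
          N ℕ.* ∣ α ∣         ≡⟨ ℤ.abs-* (ℤ.+ N) α ⟨
          ∣ ℤ.+ N ℤ.* α ∣     ≡⟨ cong ∣_∣ (ℤ.i-j≡0⇒i≡j (ℤ.+ N ℤ.* α) (ℤ.- 1ℤ) Nα+1≡0) ⟩
          1 ∎

      a-differs : ∃[ s₀ ] ∃[ s₁ ] ∃[ r₀ ] ∃[ r₁ ] a s₀ r₀ ≢ a (punchIn s₀ s₁) r₁
      a-differs with any? (λ s₀ → any? λ s₁ → any? λ r₀ → any? λ r₁ → ¬? (a s₀ r₀ ℤ.≟ a (punchIn s₀ s₁) r₁))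
      ... | yes differs = differs
      ... | no  same    = contradiction constant (a-not-constant (a zero zero))
        where
        agree : ∀ s₀ s₁ r₀ r₁ → a s₀ r₀ ≡ a (punchIn s₀ s₁) r₁
        agree s₀ s₁ r₀ r₁ = decidable-stable (a s₀ r₀ ℤ.≟ a (punchIn s₀ s₁) r₁)
          λ differ → same (s₀ , s₁ , r₀ , r₁ , differ)
        constant : ∀ s r → a s r ≡ a zero zero
        -- Two tokens of block 0 are compared through the mover of block 1.
        constant zero    r = trans (agree zero zero r zero) (sym (agree zero zero zero zero))
        constant (suc s) r = sym (agree zero s zero r)

      -- The factor `L + suc l` is 2 L - 1, and `p` is the number of blocks besides those of t₀ and
      -- t₁.
      many-crossings : p ℕ.* (L ℕ.+ suc l) ℕ.≤ k
      many-crossings with s₀ , s₁ , r₀ , r₁ , differ ← a-differs = begin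
        p ℕ.* (L ℕ.+ suc l)
          ≤⟨ blocks a X far near {s₀} {s₁} {r₀} {r₁} differ ⟩
        sum (λ s → sum (λ r → sum (λ s′ → sum (X s r s′))))
          ≡⟨ sum-cong-≗ (λ s → sum-cong-≗ (λ r → sum-combine M {L} (crossed (combine {M} {L} s r)))) ⟨
        sum (λ s → sum (λ r → sum (crossed (combine {M} {L} s r))))
          ≡⟨ sum-combine M {L} (λ i → sum (crossed i)) ⟨
        sum (λ i → sum (crossed i))
          ≡⟨ sum-crossed ⟩
        k ∎
        where open ℕ.≤-Reasoning

    -- Distances, the total and the optimum.

    cost : Fin L → ℕ
    cost zero    = L
    cost (suc _) = 0

    hop : ∀ s r → Walk (cycle n) (combine s r) (shift s r) (cost r)
    hop s (suc r) = here
    hop s zero with cyc-next s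
    ... | next _ c = climb L (begin
      toℕ (combine s zero) ℕ.+ L      ≡⟨ cong (ℕ._+ L) (toℕ-combine s zero) ⟩
      L ℕ.* toℕ s ℕ.+ 0 ℕ.+ L         ≡⟨ eq L (toℕ s) ⟩
      L ℕ.* suc (toℕ s) ℕ.+ 0         ≡⟨ cong (λ x → L ℕ.* x ℕ.+ 0) c ⟨
      L ℕ.* toℕ (cyc s) ℕ.+ 0         ≡⟨ toℕ-combine (cyc s) (zero {suc l}) ⟨
      toℕ (combine (cyc s) zero)      ∎)
      where
      open ≡-Reasoning
      open import Data.Nat.Tactic.RingSolver
      eq : ∀ L s → L ℕ.* s ℕ.+ 0 ℕ.+ L ≡ L ℕ.* suc s ℕ.+ 0
      eq = solve-∀
    -- The last mover climbs `suc l` edges to the end of its block and takes the closing edge, which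
    -- makes `L` steps.
    ... | wrap refl c = subst₂ (λ x → Walk (cycle n) top x) (cong (λ x → combine {M} {L} x zero) (sym c)) (ℕ.+-comm (suc l) 1)
      (climb-over (suc l) {top} zero (begin
        toℕ top ℕ.+ suc l                      ≡⟨ cong (ℕ._+ suc l) (toℕ-combine (fromℕ (suc p)) (zero {suc l})) ⟩
        L ℕ.* toℕ (fromℕ (suc p)) ℕ.+ 0 ℕ.+ suc l ≡⟨ cong (λ x → L ℕ.* x ℕ.+ 0 ℕ.+ suc l) (toℕ-fromℕ (suc p)) ⟩
        L ℕ.* suc p ℕ.+ 0 ℕ.+ suc l            ≡⟨ eq L p l ⟩
        suc n ∎))
      where
      open ≡-Reasoning
      open import Data.Nat.Tactic.RingSolver
      eq : ∀ L p l → L ℕ.* suc p ℕ.+ 0 ℕ.+ suc l ≡ suc (l ℕ.+ suc p ℕ.* L)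
      eq = solve-∀

    -- Tokens are named after their starting vertices, so `crossings` applies with the identity
    -- permutation.
    rotation : Instance
    rotation = record
      { n      = N
      ; graph  = cycle n
      ; start  = mk↣ {to = id} id
      ; target = mk↣ σ-injective
      }

    position : Fin N → Fin L
    position t = proj₂ (remQuot {M} L t)

    walk : ∀ t → Walk (cycle n) t (σ t) (cost (position t))
    walk t = subst (λ x → Walk (cycle n) x (σ t) (cost (position t))) (combine-remQuot {M} L t)
                   (uncurry hop (remQuot {M} L t))

    distance : ∀ t → ∃[ d ] IsDist (cycle n) t (σ t) d × d ℕ.≤ cost (position t)
    distance t = least (walk? (cycle n) t (σ t)) (walk t)

    total≤N : sum (proj₁ ∘ distance) ℕ.≤ N
    total≤N = begin
      sum (proj₁ ∘ distance)                ≤⟨ sum-mono (proj₂ ∘ proj₂ ∘ distance) ⟩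
      sum (cost ∘ position)                 ≡⟨ sum-combine M {L} (cost ∘ position) ⟩
      sum (λ s → sum (λ r → cost (position (combine {M} {L} s r))))
        ≡⟨ sum-cong-≗ (λ s → sum-cong-≗ (λ r → cong (cost ∘ proj₂) (remQuot-combine {M} {L} s r))) ⟩
      sum {M} (λ s → sum cost)              ≤⟨ sum-≤-const {M} {L} (λ s → ℕ.≤-reflexive sum-cost) ⟩
      N ∎
      where
      open ℕ.≤-Reasoning
      sum-cost : sum cost ≡ L
      sum-cost = trans (cong (L ℕ.+_) (sum-replicate-zero (suc l))) (ℕ.+-identityʳ L)

    -- This rules out the trivial examples in which no token has to move. Token `zero` is the mover
    -- of block 0, and its target lies in block 1.
    total>0 : 0 ℕ.< sum (proj₁ ∘ distance)
    total>0 = ℕ.<-≤-trans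
      (ℕ.n≢0⇒n>0 λ d≡0 → moved (stays (subst (Walk (cycle n) zero (σ zero)) d≡0 (proj₁ (proj₁ (proj₂ (distance zero)))))))
      (term≤sum (proj₁ ∘ distance) zero)
      where
      stays : ∀ {u v} → Walk (cycle n) u v 0 → u ≡ v
      stays here = refl
      moved : zero ≢ σ zero
      moved eq with cyc-next {suc p} zero
      ... | next _ c = contradiction
        (trans (cong toℕ (combine-injectiveˡ {M} zero (zero {suc l}) (cyc zero) zero eq)) c) λ ()

    -- Routing supplies some swap sequence reaching the target, and bounded search then finds the
    -- least length.
    optimum : ∃[ m ] IsOPT rotation m
    optimum = let realised es reaches = realise-injective (cycle n) connected σ σ-injective
                  m , minimal , _ = least (swaps? (cycle n) id σ) (es , refl , reaches id)
              in m , minimal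

    IsOPT⇒≥ : ∀ {m} → IsOPT rotation m → p ℕ.* (L ℕ.+ suc l) ℕ.≤ m
    IsOPT⇒≥ ((es , refl , reaches) , _) = many-crossings reaches (crossings Perm.id es)

    rotation-total : IsTotal rotation (sum (proj₁ ∘ distance))
    rotation-total = proj₁ ∘ distance , proj₁ ∘ proj₂ ∘ distance , refl

    extremal : Σ[ K ∈ Instance ] ∃[ opt ] ∃[ total ]
               IsOPT K opt × IsTotal K total × 0 ℕ.< total ×
               total ℕ.≤ M ℕ.* L × p ℕ.* (L ℕ.+ suc l) ℕ.≤ opt
    extremal = let opt , isOPT = optimum in
      rotation , opt , _ , isOPT , rotation-total , total>0 , total≤N , IsOPT⇒≥ isOPT

-- From rational numbers to an inequality of natural numbers.

module Ratio where
  open import Data.Integer as ℤ using (ℤ; +_; -_; _+_; _*_; _≤_)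
  import Data.Integer.Properties as ℤ
  open import Data.Nat as ℕ using (ℕ; suc)
  import Data.Nat.Properties as ℕ
  open import Data.Rational as ℚ using (ℚ; 0ℚ; ↧ₙ_; mkℚ; toℚᵘ)
  import Data.Rational.Properties as ℚ
  open import Data.Rational.Unnormalised as ℚᵘ using (mkℚᵘ)
  import Data.Rational.Unnormalised.Properties as ℚᵘ
  open import Relation.Binary.PropositionalEquality using (_≡_; trans; cong; subst)

  -- A positive δ with denominator d is at least 1/d, and the hypothesis is the case δ = 1/d cleared
  -- of denominators. Unnormalised rationals avoid reduction by common divisors.
  ratio-≤ : ∀ δ → 0ℚ ℚ.< δ → ∀ {total opt} →
            2 ℕ.* ↧ₙ δ ℕ.* total ℕ.≤ opt ℕ.* ↧ₙ δ ℕ.+ total →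
            (+ 2 ℚ./ 1 ℚ.- δ) ℚ.* (+ total ℚ./ 1) ℚ.≤ + opt ℚ./ 1
  ratio-≤ δ@(mkℚ m d-1 _) 0<δ {total} {opt} le = ℚ.toℚᵘ-cancel-≤ (begin
    toℚᵘ ((+ 2 ℚ./ 1 ℚ.- δ) ℚ.* (+ total ℚ./ 1))
      ≃⟨ ℚ.toℚᵘ-homo-* (+ 2 ℚ./ 1 ℚ.- δ) (+ total ℚ./ 1) ⟩
    toℚᵘ (+ 2 ℚ./ 1 ℚ.- δ) ℚᵘ.* toℚᵘ (+ total ℚ./ 1)
      ≃⟨ ℚᵘ.*-cong (ℚᵘ.≃-trans (ℚ.toℚᵘ-homo-+ (+ 2 ℚ./ 1) (ℚ.- δ)) (ℚᵘ.+-congʳ (mkℚᵘ (+ 2) 0) (ℚ.toℚᵘ-homo‿- δ)))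
                   (ℚ.toℚᵘ-fromℚᵘ (mkℚᵘ (+ total) 0)) ⟩
    (mkℚᵘ (+ 2) 0 ℚᵘ.- mkℚᵘ m d-1) ℚᵘ.* mkℚᵘ (+ total) 0
      ≤⟨ ℚᵘ.*≤* numerators ⟩
    mkℚᵘ (+ opt) 0
      ≃⟨ ℚ.toℚᵘ-fromℚᵘ (mkℚᵘ (+ opt) 0) ⟨
    toℚᵘ (+ opt ℚ./ 1) ∎)
    where
    open ℚᵘ.≤-Reasoning
    d = suc d-1
    1≤m : + 1 ≤ m
    1≤m = ℤ.i<j⇒suc[i]≤j (subst (+ 0 ℤ.<_) (ℤ.*-identityʳ m) (ℚ.drop-*<* 0<δ))
    -- The literal cross-multiplication; the factors 1 are denominators of integers.
    numerators : (+ 2 * + d + - m * + 1) * + total * + 1 ≤ + opt * + (1 ℕ.* d ℕ.* 1)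
    numerators = ℤ-≤.begin
      (+ 2 * + d + - m * + 1) * + total * + 1
        ℤ-≤.≤⟨ ℤ.*-monoʳ-≤-nonNeg (+ 1) (ℤ.*-monoʳ-≤-nonNeg (+ total)
               (ℤ.+-monoʳ-≤ (+ 2 * + d) (ℤ.*-monoʳ-≤-nonNeg (+ 1) (ℤ.neg-mono-≤ 1≤m)))) ⟩
      (+ 2 * + d + - + 1 * + 1) * + total * + 1
        ℤ-≤.≡⟨ expand (+ 2) (+ d) (+ total) ⟩
      + 2 * + d * + total + - + total
        ℤ-≤.≡⟨ cong (_+ - + total) (trans (ℤ.pos-* (2 ℕ.* d) total) (cong (_* + total) (ℤ.pos-* 2 d))) ⟨
      + (2 ℕ.* d ℕ.* total) + - + total
        ℤ-≤.≤⟨ ℤ.+-monoˡ-≤ (- + total) (ℤ.+≤+ le) ⟩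
      + (opt ℕ.* d ℕ.+ total) + - + total
        ℤ-≤.≡⟨ cong (_+ - + total) (cong (_+ + total) (ℤ.pos-* opt d)) ⟩
      + opt * + d + + total + - + total
        ℤ-≤.≡⟨ collapse (+ opt) (+ d) (+ total) ⟩
      + opt * (+ 1 * + d * + 1)
        ℤ-≤.≡⟨ cong (+ opt *_) (trans (ℤ.pos-* (1 ℕ.* d) 1) (cong (_* + 1) (ℤ.pos-* 1 d))) ⟨
      + opt * + (1 ℕ.* d ℕ.* 1) ℤ-≤.∎
      where
      module ℤ-≤ = ℤ.≤-Reasoning
      open import Data.Integer.Tactic.RingSolver
      expand : ∀ b d t → (b * d + - + 1 * + 1) * t * + 1 ≡ b * d * t + - t
      expand = solve-∀
      collapse : ∀ o d t → o * d + t + - t ≡ o * (+ 1 * d * + 1)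
      collapse = solve-∀

-- The polynomial inequality behind the choice of parameters.

module Parameters where
  open import Data.Nat using (suc; _+_; _*_; _≤_)
  open import Data.Nat.Properties
  open import Data.Nat.Tactic.RingSolver
  open import Relation.Binary.PropositionalEquality using (_≡_)

  -- For p = 1 + l = K the two bounds have quotient
  -- K (2K + 1) / (K + 1)(K + 2) ≥ 2 - 5 / K.
  parameters : ∀ d-1 {total opt} → let d = suc d-1 ; l = 5 * d ; p = 1 + l in
               total ≤ (2 + p) * (2 + l) → p * (2 + l + suc l) ≤ opt →
               2 * d * total ≤ opt * d + total
  parameters e {total} {opt} total≤ ≤opt = begin
    2 * suc e * total                     ≡⟨ split e total ⟩
    (1 + 2 * e) * total + total           ≤⟨ +-monoˡ-≤ total (begin
      (1 + 2 * e) * total                           ≤⟨ *-monoʳ-≤ (1 + 2 * e) total≤ ⟩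
      (1 + 2 * e) * ((3 + 5 * suc e) * (2 + 5 * suc e))
        -- The slack `16 * e + 22` is the exact difference of the two polynomials in `e`, where d is
        -- `suc e` and 2 d - 1 is `1 + 2 * e`.
        ≤⟨ m≤m+n _ (16 * e + 22) ⟩
      (1 + 2 * e) * ((3 + 5 * suc e) * (2 + 5 * suc e)) + (16 * e + 22)
        ≡⟨ balance e ⟩
      (1 + 5 * suc e) * (2 + 5 * suc e + suc (5 * suc e)) * suc e
        ≤⟨ *-monoˡ-≤ (suc e) ≤opt ⟩
      opt * suc e ∎) ⟩
    opt * suc e + total ∎
    where
    open ≤-Reasoning
    split : ∀ e t → 2 * suc e * t ≡ (1 + 2 * e) * t + t
    split = solve-∀
    balance : ∀ e → (1 + 2 * e) * ((3 + 5 * suc e) * (2 + 5 * suc e)) + (16 * e + 22)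
                  ≡ (1 + 5 * suc e) * (2 + 5 * suc e + suc (5 * suc e)) * suc e
    balance = solve-∀

-- The ratio 2 - δ for an arbitrary positive δ.

open import Data.Nat as ℕ using (ℕ)
open import Data.Integer using (+_)
open import Data.Rational using (ℚ; mkℚ; 0ℚ; _/_; _-_; _*_; _≤_; _<_)
open import Data.Product using (Σ-syntax; _×_; _,_)

theorem5p6 : ∀ (δ : ℚ) → 0ℚ < δ →
    Σ[ K ∈ Instance ] Σ[ opt ∈ ℕ ] Σ[ total ∈ ℕ ]
    IsOPT K opt ×
    IsTotal K total ×
    0 ℕ.< total ×
    (+ 2 / 1 - δ) * (+ total / 1) ≤ + opt / 1
theorem5p6 δ@(mkℚ _ d-1 _) 0<δ = conclude (extremal p l)
  where
  open Configuration
  open Ratio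
  open Parameters
  -- With d the denominator of δ, this gives `p` = 1 + 5 d, so the loss of at most 5 / `p` stays
  -- below 1/d and hence below δ.
  l = 5 ℕ.* ℕ.suc d-1
  p = 1 ℕ.+ l
  conclude : Σ[ K ∈ Instance ] Σ[ opt ∈ ℕ ] Σ[ total ∈ ℕ ]
               IsOPT K opt × IsTotal K total × 0 ℕ.< total ×
               total ℕ.≤ (2 ℕ.+ p) ℕ.* (2 ℕ.+ l) × p ℕ.* (2 ℕ.+ l ℕ.+ ℕ.suc l) ℕ.≤ opt →
             Σ[ K ∈ Instance ] Σ[ opt ∈ ℕ ] Σ[ total ∈ ℕ ]
               IsOPT K opt × IsTotal K total × 0 ℕ.< total ×
               (+ 2 / 1 - δ) * (+ total / 1) ≤ + opt / 1
  conclude (K , opt , total , isOPT , isTotal , total>0 , total≤ , ≤opt) =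
    K , opt , total , isOPT , isTotal , total>0 , ratio-≤ δ 0<δ {total} {opt}
      (parameters d-1 {total} {opt} total≤ ≤opt)
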